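{- Let $\mathcal{S}$ be a high-density subset of the squares, and suppose that $\mathcal{A}\subseteq\mathbb{N}$ has complementary density growth exponent smaller than $1$. Then, whenever $\varepsilon>0$ and $N$ is a natural number sufficiently large in terms of $\varepsilon$ (for the given sets $\mathcal{S}$ and $\mathcal{A}$), one has $$\left|\overline{\mathcal{A}+\mathcal{S}}\right|_{2N}^{3N}\ll N^{\varepsilon-1/2}\left|\overline{\mathcal{A}}\right|_N^{3N}.$$
   Context: $\mathbb{N}$ denotes the set of positive integers. For $\mathcal{C}\subseteq\mathbb{N}$, $\overline{\mathcal{C}}=\mathbb{N}\setminus\mathcal{C}$; for non-negative integers $a,b$, $|\mathcal{C}|_a^b$ is the cardinality of $\mathcal{C}\cap(a,b]$; and $\mathcal{C}+\mathcal{D}=\{c+d:c\in\mathcal{C},\ d\in\mathcal{D}\}$. For a natural number $k$, a subset $\mathcal{Q}$ of $\mathbb{N}$ is a high-density subset of the $k$th powers when (i) $\mathcal{Q}\subseteq\{n^k:n\in\mathbb{N}\}$, and (ii) for each $\varepsilon>0$, whenever $N$ is a natural number sufficiently large in terms of $\varepsilon$, one has $|\mathcal{Q}|_0^N>N^{1/k-\varepsilon}$. The squares are the case $k=2$. For $\theta>0$, a set $\mathcal{R}\subseteq\mathbb{N}$ has complementary density growth exponent smaller than $\theta$ when there exists $\delta>0$ such that, for all sufficiently large natural numbers $N$, one has $\left|\overline{\mathcal{R}}\right|_0^N<N^{\theta-\delta}$. The notation $X\ll Y$ means $|X|\leqslant CY$ for a constant $C$ depending at most on $\varepsilon$. The sets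 $\mathcal{S},\mathcal{A}$ are fixed first, and the threshold beyond which $N$ must lie may depend on $\varepsilon$ and on these sets. -}

module Defs where

open import Level using (0ℓ)
open import Data.Nat.Base using (ℕ; zero; suc; _+_; _*_; _^_; _≤_; _<_; NonZero)
open import Data.Integer.Base as ℤ using (ℤ; +_; -[1+_])
open import Data.Rational.Unnormalised.Base as ℚᵘ using (ℚᵘ; 0ℚᵘ; 1ℚᵘ; ↥_; ↧ₙ_)
open import Data.List.Base using (List; length)
import Data.List.Membership.Propositional as List
open import Data.List.Relation.Unary.Unique.Propositional using (Unique)
open import Data.Product.Base using (_×_; ∃-syntax)
open import Function.Bundles using (_⇔_)
open import Relation.Binary.PropositionalEquality.Core using (_≡_)
open import Relation.Unary using (Pred; _∈_; _⊆_; _∩_; _∖_)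

-- Sets of positive integers are arbitrary (not necessarily decidable)
-- predicates on ℕ contained in ℕ⁺.

ℕ⁺ : Pred ℕ 0ℓ
ℕ⁺ n = 0 < n

infix 20 _ᶜ
_ᶜ : Pred ℕ 0ℓ → Pred ℕ 0ℓ
C ᶜ = ℕ⁺ ∖ C

infixl 15 _⊕_
_⊕_ : Pred ℕ 0ℓ → Pred ℕ 0ℓ → Pred ℕ 0ℓ
(C ⊕ D) n = ∃[ c ] ∃[ d ] c ∈ C × d ∈ D × n ≡ c + d

⦅_,_⟧ : ℕ → ℕ → Pred ℕ 0ℓ
⦅ a , b ⟧ n = a < n × n ≤ b

HasCard : Pred ℕ 0ℓ → ℕ → Set
HasCard P m =
  ∃[ xs ] Unique xs × length xs ≡ m × (∀ n → (n List.∈ xs) ⇔ (n ∈ P))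

-- ∣ C ∣⟨ a , b ⟩≔ m  says that |C|ₐᵇ, the cardinality of C ∩ (a,b], is m.
-- The cardinality of a bounded set is unique, and it exists classically but
-- cannot be computed for an undecidable C.  A property of |C|ₐᵇ is therefore
-- written  ∀ m → ∣ C ∣⟨ a , b ⟩≔ m → …

∣_∣⟨_,_⟩≔_ : Pred ℕ 0ℓ → ℕ → ℕ → ℕ → Set
∣ C ∣⟨ a , b ⟩≔ m = HasCard (C ∩ ⦅ a , b ⟧) m

-- Every use of ε and δ is monotone in ε and δ, so letting them range
-- over the positive rationals is the same as letting them range over the
-- positive reals.  For θ = p/q with q > 0, and p = p⁺ - p⁻, the comparisons
-- with N^θ are the following, raised to the power q and multiplied by N^p⁻;
-- for N > 0 they do not depend on the fraction representing θ.

_⁺ _⁻ : ℤ → ℕ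
(+ n) ⁺    = n
-[1+ n ] ⁺ = 0
(+ n) ⁻    = 0
-[1+ n ] ⁻ = suc n

-- N^θ < y
[_^_]<_ : ℕ → ℚᵘ → ℕ → Set
[ N ^ θ ]< y = N ^ ((↥ θ) ⁺) < N ^ ((↥ θ) ⁻) * y ^ (↧ₙ θ)

-- x < N^θ
_<[_^_] : ℕ → ℕ → ℚᵘ → Set
x <[ N ^ θ ] = N ^ ((↥ θ) ⁻) * x ^ (↧ₙ θ) < N ^ ((↥ θ) ⁺)

-- x ≤ N^θ y
_≤[_^_]*_ : ℕ → ℕ → ℚᵘ → ℕ → Set
x ≤[ N ^ θ ]* y = N ^ ((↥ θ) ⁻) * x ^ (↧ₙ θ) ≤ N ^ ((↥ θ) ⁺) * y ^ (↧ₙ θ)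

Eventually : Pred ℕ 0ℓ → Set
Eventually P = ∃[ N₀ ] (∀ N → N₀ ≤ N → N ∈ P)

Powers : ℕ → Pred ℕ 0ℓ
Powers k m = ∃[ n ] n ∈ ℕ⁺ × m ≡ n ^ k

HighDensity : (k : ℕ) .{{_ : NonZero k}} → Pred ℕ 0ℓ → Set
HighDensity k Q =
  Q ⊆ Powers k ×
  (∀ ε → 0ℚᵘ ℚᵘ.< ε →
    Eventually λ N → ∀ m → ∣ Q ∣⟨ 0 , N ⟩≔ m → [ N ^ (+ 1 ℚᵘ./ k) ℚᵘ.- ε ]< m)

ComplementaryGrowthExponent< : ℚᵘ → Pred ℕ 0ℓ → Set
ComplementaryGrowthExponent< θ R =
  ∃[ δ ] 0ℚᵘ ℚᵘ.< δ ×
    (Eventually λ N → ∀ m → ∣ R ᶜ ∣⟨ 0 , N ⟩≔ m → m <[ N ^ θ ℚᵘ.- δ ])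

module Submission where

open import Defs
open import Level using (0ℓ)
open import Data.Integer.Base as ℤ using (ℤ; +_; -[1+_])
import Data.Integer.Properties as ℤ
import Data.Integer.Tactic.RingSolver as ℤ
open import Data.List.Base using (List; []; _∷_; _++_; map; length; filter)
import Data.List.Membership.DecPropositional as DecMembership
import Data.List.Membership.Propositional as List
open import Data.List.Membership.Propositional.Properties
  using (∈-map⁺; ∈-map⁻; ∈-++⁺ˡ; ∈-++⁺ʳ; ∈-++⁻; ∈-filter⁺; ∈-filter⁻)
open import Data.List.Properties using (length-map; length-++; filter-notAll)
open import Data.List.Relation.Unary.All as All using (All; []; _∷_)
import Data.List.Relation.Unary.All.Properties as All
open import Data.List.Relation.Unary.AllPairs using ([]; _∷_)
open import Data.List.Relation.Unary.Any as Any using (here; there)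
open import Data.List.Relation.Unary.Unique.Propositional using (Unique)
import Data.List.Relation.Unary.Unique.Propositional.Properties as Unique
open import Data.Nat.Base
open import Data.Nat.Coprimality using (Coprime; coprime-divisor)
open import Data.Nat.Divisibility
open import Data.Nat.DivMod using (m*n/n≡m; m≡m%n+[m/n]*n; m%n<n; m/n*n≤m)
open import Data.Nat.Induction using (<-rec)
open import Data.Nat.Primality
  using (Prime; _Rough_; 2-rough; rough⇒≤; ∤⇒rough-suc; rough∧∣⇒rough; rough∧∣⇒prime;
         prime⇒irreducible; prime⇒nonZero)
open import Data.Nat.Properties
open import Data.Nat.Tactic.RingSolver using (solve-∀)
open import Data.Product.Base using (_×_; _,_; ∃-syntax; proj₁; proj₂)
open import Data.Rational.Unnormalised.Base as ℚᵘ using (ℚᵘ; mkℚᵘ; 0ℚᵘ; 1ℚᵘ; ½; ↥_; ↧ₙ_)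
import Data.Rational.Unnormalised.Properties as ℚᵘ
open import Data.Sum.Base as Sum using (_⊎_; inj₁; inj₂)
open import Function.Base using (_∘_; id)
open import Function.Bundles using (_⇔_; Equivalence; mk⇔)
open import Relation.Binary.Definitions using (DecidableEquality; tri<; tri≈; tri>)
open import Relation.Binary.PropositionalEquality
open import Relation.Nullary using (¬_; yes; no; contradiction; ¬?; ¬¬-excluded-middle)
open import Relation.Nullary.Decidable using (decidable-stable)
open import Relation.Unary using (Pred; _∩_; _∈_; _⊆_)

-- Let m = |S|₀ᴺ.  Every n ∈ (2N, 3N] outside A + S yields m elements n - s of the
-- complement of A in (N, 3N].  Two distinct n, n′ share at most D = N^o(1) of them, since a
-- coincidence n - a² = n′ - b² factors n - n′ = (a - b)(a + b) and the number of divisors is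
-- at most N^o(1).  With x exceptional n and y elements in the complement of A, adding the
-- sets n - S one at a time gives x m ≤ 2y or m² ≤ 4Dy.  The first is the claim, as
-- m > N^(1/2-ε); the second fails for large N, because m² > N^(1-o(1)) whereas
-- y < (3N)^(1-δ).  The cardinality m exists only up to double negation, which is harmless as
-- the claim is decidable.

-- The divisor bound

^-distribʳ-* : ∀ m n k → (m * n) ^ k ≡ m ^ k * n ^ k
^-distribʳ-* m n zero    = refl
^-distribʳ-* m n (suc k) = begin-equality
  m * n * (m * n) ^ k        ≡⟨ cong (m * n *_) (^-distribʳ-* m n k) ⟩
  m * n * (m ^ k * n ^ k)    ≡⟨ [m*n]*[o*p]≡[m*o]*[n*p] m n (m ^ k) (n ^ k) ⟩
  m * m ^ k * (n * n ^ k)    ∎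
  where open ≤-Reasoning

n<2^n : ∀ n → n < 2 ^ n
n<2^n zero    = z<s
n<2^n (suc n) = begin
  2 + n            ≡⟨ +-comm 1 (suc n) ⟩
  suc n + 1        ≤⟨ +-mono-≤ (n<2^n n) (m^n>0 2 n) ⟩
  2 ^ n + 2 ^ n    ≡⟨ cong (λ t → 2 ^ n + t) (+-identityʳ (2 ^ n)) ⟨
  2 ^ suc n        ∎
  where open ≤-Reasoning

-- With q = ⌊a/k⌋ one has 1 + a ≤ k (1 + q) ≤ k 2^q, and 2^(qk) ≤ 2^a.
suc^k≤k^k*2^ : ∀ k .{{_ : NonZero k}} a → suc a ^ k ≤ k ^ k * 2 ^ a
suc^k≤k^k*2^ k a = begin
  suc a ^ k              ≤⟨ ^-monoˡ-≤ k 1+a≤k*2^q ⟩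
  (k * 2 ^ q) ^ k        ≡⟨ ^-distribʳ-* k (2 ^ q) k ⟩
  k ^ k * (2 ^ q) ^ k    ≡⟨ cong (k ^ k *_) (^-*-assoc 2 q k) ⟩
  k ^ k * 2 ^ (q * k)    ≤⟨ *-monoʳ-≤ (k ^ k) (^-monoʳ-≤ 2 (m/n*n≤m a k)) ⟩
  k ^ k * 2 ^ a          ∎
  where
  open ≤-Reasoning
  q = a / k
  1+a≤k*2^q : suc a ≤ k * 2 ^ q
  1+a≤k*2^q = begin
    suc a              ≡⟨ cong suc (m≡m%n+[m/n]*n a k) ⟩
    suc (_ + q * k)    ≤⟨ +-monoˡ-≤ (q * k) (m%n<n a k) ⟩
    suc q * k          ≡⟨ *-comm (suc q) k ⟩
    k * suc q          ≤⟨ *-monoʳ-≤ k (n<2^n q) ⟩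
    k * 2 ^ q          ∎

-- The list may repeat entries and contain non-divisors: only its length enters, as an upper bound
-- for the number of divisors.
CoversDivisors : ℕ → List ℕ → Set
CoversDivisors n ds = ∀ d → d ∣ n → d List.∈ ds

prime∧∤⇒coprime : ∀ {p d} → Prime p → p ∤ d → Coprime d p
prime∧∤⇒coprime p-prime p∤d (c∣d , c∣p) with prime⇒irreducible p-prime c∣p
... | inj₁ c≡1 = c≡1
... | inj₂ refl = contradiction c∣d p∤d

∣p^a*m⇒∣m : ∀ {p d} → Prime p → p ∤ d → ∀ a m → d ∣ p ^ a * m → d ∣ m
∣p^a*m⇒∣m p-prime p∤d zero    m d∣ = subst (_ ∣_) (*-identityˡ m) d∣
∣p^a*m⇒∣m {p} {d} p-prime p∤d (suc a) m d∣ = ∣p^a*m⇒∣m p-prime p∤d a m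
  (coprime-divisor (prime∧∤⇒coprime p-prime p∤d) (subst (d ∣_) (*-assoc p (p ^ a) m) d∣))

-- A divisor of p^(a+1) m is either prime to p, and then divides m, or p times a divisor of p^a m.
-- So each further factor p adds `length ds` entries.
coverDivisors-p^a*m : ∀ {p m ds} → Prime p → CoversDivisors m ds → ∀ a →
  ∃[ ds′ ] CoversDivisors (p ^ a * m) ds′ × length ds′ ≡ suc a * length ds
coverDivisors-p^a*m {p} {m} {ds} p-prime cover zero =
  ds , (λ d d∣ → cover d (subst (d ∣_) (*-identityˡ m) d∣)) , sym (*-identityˡ (length ds))
coverDivisors-p^a*m {p} {m} {ds} p-prime cover (suc a)
  with ds′ , cover′ , length-ds′ ← coverDivisors-p^a*m {ds = ds} p-prime cover a =
  ds ++ map (p *_) ds′ , cover″ , length-ds″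
  where
  cover″ : CoversDivisors (p ^ suc a * m) (ds ++ map (p *_) ds′)
  cover″ d d∣ with p ∣? d
  ... | no p∤d = ∈-++⁺ˡ (cover d (∣p^a*m⇒∣m p-prime p∤d (suc a) m d∣))
  ... | yes (divides q refl) = ∈-++⁺ʳ ds (subst (List._∈ map (p *_) ds′) (*-comm p q)
        (∈-map⁺ (p *_) (cover′ q (*-cancelˡ-∣ p
          (subst₂ _∣_ (*-comm q p) (*-assoc p (p ^ a) m) d∣)))))
    where instance _ = prime⇒nonZero p-prime
  length-ds″ : length (ds ++ map (p *_) ds′) ≡ suc (suc a) * length ds
  length-ds″ = trans (length-++ ds)
    (cong (λ t → length ds + t) (trans (length-map (p *_) ds′) length-ds′))

splitPower : ∀ p .{{_ : NonTrivial p}} n .{{_ : NonZero n}} →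
  ∃[ a ] ∃[ m ] n ≡ p ^ a * m × p ∤ m
splitPower p = <-rec (λ n → .{{_ : NonZero n}} → ∃[ a ] ∃[ m ] n ≡ p ^ a * m × p ∤ m) step
  where
  step : ∀ n → (∀ {m} → m < n → .{{_ : NonZero m}} → ∃[ a ] ∃[ b ] m ≡ p ^ a * b × p ∤ b) →
         .{{_ : NonZero n}} → ∃[ a ] ∃[ b ] n ≡ p ^ a * b × p ∤ b
  step n rec with p ∣? n
  ... | no p∤n = 0 , n , sym (*-identityˡ n) , p∤n
  ... | yes p∣n@(divides q refl) with rec (quotient-< p∣n) {{quotient≢0 p∣n}}
  ... | a , m , refl , p∤m = suc a , m , eq , p∤m
    where
    eq : p ^ a * m * p ≡ p * p ^ a * m
    eq = trans (*-comm (p ^ a * m) p) (sym (*-assoc p (p ^ a) m))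

-- A prime p ≥ 2^k divides n exactly a times at no cost, as (1 + a)^k ≤ 2^(ka) ≤ p^a;
-- each smaller p costs a factor k^k.
primeFactorCost : ∀ k .{{_ : NonZero k}} p → 2 ≤ p → ∀ a →
  suc a ^ k * (k ^ k) ^ (2 ^ k ∸ suc p) ≤ (k ^ k) ^ (2 ^ k ∸ p) * p ^ a
primeFactorCost k p 2≤p a with p <? 2 ^ k
... | yes p<2^k = begin
  suc a ^ k * K ^ (2 ^ k ∸ suc p)           ≤⟨ *-monoˡ-≤ _ (suc^k≤k^k*2^ k a) ⟩
  K * 2 ^ a * K ^ (2 ^ k ∸ suc p)           ≡⟨ lemma K (2 ^ a) _ ⟩
  K * K ^ (2 ^ k ∸ suc p) * 2 ^ a           ≡⟨⟩
  K ^ suc (2 ^ k ∸ suc p) * 2 ^ a           ≡⟨ cong (λ e → K ^ e * 2 ^ a) (+-∸-assoc 1 p<2^k) ⟨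
  K ^ (2 ^ k ∸ p) * 2 ^ a                   ≤⟨ *-monoʳ-≤ (K ^ (2 ^ k ∸ p)) (^-monoˡ-≤ a 2≤p) ⟩
  K ^ (2 ^ k ∸ p) * p ^ a                   ∎
  where
  open ≤-Reasoning
  K = k ^ k
  lemma : ∀ x y z → x * y * z ≡ x * z * y
  lemma = solve-∀
... | no p≮2^k = begin
  suc a ^ k * K ^ (2 ^ k ∸ suc p)   ≡⟨ cong (λ e → suc a ^ k * K ^ e) (m≤n⇒m∸n≡0 (m≤n⇒m≤1+n 2^k≤p)) ⟩
  suc a ^ k * 1                     ≡⟨ *-identityʳ _ ⟩
  suc a ^ k                         ≤⟨ ^-monoˡ-≤ k (n<2^n a) ⟩
  (2 ^ a) ^ k                       ≡⟨ trans (^-*-assoc 2 a k) (cong (2 ^_) (*-comm a k)) ⟩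
  2 ^ (k * a)                       ≡⟨ ^-*-assoc 2 k a ⟨
  (2 ^ k) ^ a                       ≤⟨ ^-monoˡ-≤ a 2^k≤p ⟩
  p ^ a                             ≡⟨ *-identityˡ (p ^ a) ⟨
  1 * p ^ a                         ≡⟨ cong (λ e → K ^ e * p ^ a) (m≤n⇒m∸n≡0 2^k≤p) ⟨
  K ^ (2 ^ k ∸ p) * p ^ a           ∎
  where
  open ≤-Reasoning
  K = k ^ k
  2^k≤p = ≮⇒≥ p≮2^k

-- Trial division: p runs upwards, its full power is split off, and the cofactor has no prime factor
-- up to p. The power of k^k is the budget for the values from p on that lie below 2^k; p + `fuel`
-- stays constant and above n.
roughDivisorBound : ∀ k .{{_ : NonZero k}} fuel p n .{{_ : NonZero n}} →
  2 ≤ p → n < p + fuel → p Rough n →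
  ∃[ ds ] CoversDivisors n ds × length ds ^ k ≤ (k ^ k) ^ (2 ^ k ∸ p) * n
roughDivisorBound k fuel p 1 2≤p n<p+fuel rough =
  (1 ∷ []) , (λ d d∣1 → here (∣1⇒≡1 d∣1)) , (begin
    1 ^ k    ≡⟨ ^-zeroˡ k ⟩
    1        ≤⟨ m^n>0 (k ^ k) {{m^n≢0 k k}} (2 ^ k ∸ p) ⟩
    (k ^ k) ^ (2 ^ k ∸ p)  ≡⟨ *-identityʳ _ ⟨
    (k ^ k) ^ (2 ^ k ∸ p) * 1 ∎)
  where open ≤-Reasoning
-- Without fuel n < p, whereas a p-rough n ≥ 2 is at least p.
roughDivisorBound k zero p n@(2+ _) 2≤p n<p+fuel rough =
  contradiction (rough⇒≤ rough) (<⇒≱ (subst (n <_) (+-identityʳ p) n<p+fuel))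
roughDivisorBound k (suc fuel) p n@(2+ _) 2≤p n<p+fuel rough
  with splitPower p {{n>1⇒nonTrivial 2≤p}} n
... | a , m , n≡ , p∤m
  with roughDivisorBound k fuel (suc p) m {{m≢0}} (m≤n⇒m≤1+n 2≤p) m<
         (∤⇒rough-suc p∤m (rough∧∣⇒rough rough m∣n))
  where
  m∣n : m ∣ n
  m∣n = divides (p ^ a) n≡
  m≢0 : NonZero m
  m≢0 = ≢-nonZero (λ { refl → contradiction (p ∣0) p∤m })
  m< : m < suc p + fuel
  m< = ≤-<-trans (∣⇒≤ m∣n) (subst (n <_) (+-suc p fuel) n<p+fuel)
... | ds , cover , length-ds = combine (coverPower a n≡)
  where
  open ≤-Reasoning
  K = k ^ k
  coverPower : ∀ a → n ≡ p ^ a * m →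
    ∃[ ds′ ] CoversDivisors (p ^ a * m) ds′ × length ds′ ≡ suc a * length ds
  -- The running p may be composite. It is prime as soon as it divides the p-rough n, so a = 0 is
  -- treated apart.
  coverPower zero    eq = ds , subst (λ x → CoversDivisors x ds) (sym (*-identityˡ m)) cover , sym (*-identityˡ _)
  coverPower (suc a) eq = coverDivisors-p^a*m
    (rough∧∣⇒prime {{n>1⇒nonTrivial 2≤p}} rough
      (divides (p ^ a * m) (trans eq (trans (*-assoc p (p ^ a) m) (*-comm p (p ^ a * m))))))
    cover (suc a)
  combine : (∃[ ds′ ] CoversDivisors (p ^ a * m) ds′ × length ds′ ≡ suc a * length ds) →
    ∃[ ds′ ] CoversDivisors n ds′ × length ds′ ^ k ≤ K ^ (2 ^ k ∸ p) * n
  combine (ds′ , cover′ , length-ds′) =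
    ds′ , subst (λ x → CoversDivisors x ds′) (sym n≡) cover′ , (begin
      length ds′ ^ k                           ≡⟨ cong (_^ k) length-ds′ ⟩
      (suc a * length ds) ^ k                  ≡⟨ ^-distribʳ-* (suc a) (length ds) k ⟩
      suc a ^ k * length ds ^ k                ≤⟨ *-monoʳ-≤ (suc a ^ k) length-ds ⟩
      suc a ^ k * (K ^ (2 ^ k ∸ suc p) * m)    ≡⟨ *-assoc (suc a ^ k) _ m ⟨
      suc a ^ k * K ^ (2 ^ k ∸ suc p) * m      ≤⟨ *-monoˡ-≤ m (primeFactorCost k p 2≤p a) ⟩
      K ^ (2 ^ k ∸ p) * p ^ a * m              ≡⟨ *-assoc (K ^ (2 ^ k ∸ p)) (p ^ a) m ⟩
      K ^ (2 ^ k ∸ p) * (p ^ a * m)            ≡⟨ cong (K ^ (2 ^ k ∸ p) *_) n≡ ⟨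
      K ^ (2 ^ k ∸ p) * n                      ∎)

-- As k is arbitrary, the number of divisors of n is at most a constant times any fixed positive
-- power of n.
divisorBound : ∀ k .{{_ : NonZero k}} →
  ∃[ C ] (∀ n .{{_ : NonZero n}} → ∃[ ds ] CoversDivisors n ds × length ds ^ k ≤ C * n)
divisorBound k = (k ^ k) ^ (2 ^ k ∸ 2) , λ n → roughDivisorBound k n 2 n ≤-refl (m≤n+m (suc n) 1) 2-rough

-- Packing translates of the squares

module _ {A : Set} where

  map-unique : ∀ {B : Set} (f : A → B) {xs} →
    (∀ {x y} → x List.∈ xs → y List.∈ xs → f x ≡ f y → x ≡ y) → Unique xs → Unique (map f xs)
  map-unique f inj [] = []
  map-unique f inj (x∉xs ∷ xs!) =
    All.map⁺ (All.tabulate λ y∈xs fx≡fy → All.lookup x∉xs y∈xs (inj (here refl) (there y∈xs) fx≡fy))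
    ∷ map-unique f (λ x∈ y∈ → inj (there x∈) (there y∈)) xs!

module _ {A : Set} (_≟ᴬ_ : DecidableEquality A) where

  unique-⊆⇒length-≤ : ∀ {xs ys : List A} → Unique xs → (∀ {x} → x List.∈ xs → x List.∈ ys) →
    length xs ≤ length ys
  unique-⊆⇒length-≤ [] xs⊆ys = z≤n
  unique-⊆⇒length-≤ {x ∷ xs} {ys} (x∉xs ∷ xs!) xs⊆ys = begin-strict
    length xs               ≤⟨ unique-⊆⇒length-≤ xs! (λ y∈xs →
                                 ∈-filter⁺ ≢x? (xs⊆ys (there y∈xs)) (All.lookup x∉xs y∈xs)) ⟩
    length (filter ≢x? ys)  <⟨ filter-notAll ≢x? ys (Any.map (λ x≡y x≢y → x≢y x≡y) (xs⊆ys (here refl))) ⟩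
    length ys               ∎
    where
    open ≤-Reasoning
    ≢x? = λ y → ¬? (x ≟ᴬ y)

  -- Pack the sets f i one after another: while 2tD ≤ M, the next one still contributes
  -- at least M - tD ≥ M/2 new elements; once M < 2tD, the tM/2 elements already packed are
  -- more than M²/(4D).
  packing : ∀ {I : Set} (f : I → List A) {M D} {U : List A} →
    (∀ i → length (f i) ≡ M) → ∀ {is : List I} → Unique is →
    (∀ {i} → i List.∈ is → Unique (f i)) →
    (∀ {i a} → i List.∈ is → a List.∈ f i → a List.∈ U) →
    (∀ {i j} → i List.∈ is → j List.∈ is → i ≢ j →
       ∃[ as ] length as ≤ D × (∀ {a} → a List.∈ f i → a List.∈ f j → a List.∈ as)) →
    length is * M ≤ 2 * length U ⊎ M * M ≤ 4 * D * length U
  packing {I} f {M} {D} {U} length-f {is} is! f! f⊆U overlap-≤ =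
    Sum.map₁ (λ (vs , vs! , vs-from , tM≤2∣vs∣) → ≤-trans tM≤2∣vs∣ (*-monoʳ-≤ 2 (packed-≤ id vs! vs-from))) (pack is! id)
    where
    From : List I → List A → Set
    From js vs = ∀ {a} → a List.∈ vs → ∃[ j ] j List.∈ js × a List.∈ f j

    packed-≤ : ∀ {js vs} → (∀ {j} → j List.∈ js → j List.∈ is) → Unique vs → From js vs → length vs ≤ length U
    packed-≤ js⊆is vs! from = unique-⊆⇒length-≤ vs! λ a∈vs →
      let j , j∈js , a∈fj = from a∈vs in f⊆U (js⊆is j∈js) a∈fj

    -- What f i shares with t sets already packed lies in the concatenation of the pairwise
    -- overlaps, of length at most t D.
    overlaps : ∀ {i js} → i List.∈ is → (∀ {j} → j List.∈ js → j List.∈ is) → All (i ≢_) js →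
      ∃[ as ] length as ≤ length js * D × (∀ {a j} → a List.∈ f i → j List.∈ js → a List.∈ f j → a List.∈ as)
    overlaps i∈is js⊆is [] = [] , z≤n , λ { _ () }
    overlaps i∈is js⊆is (i≢j ∷ i∉js)
      with as , ∣as∣≤ , as-cover ← overlap-≤ i∈is (js⊆is (here refl)) i≢j
         | bs , ∣bs∣≤ , bs-cover ← overlaps i∈is (js⊆is ∘ there) i∉js =
      as ++ bs , subst (_≤ _) (sym (length-++ as)) (+-mono-≤ ∣as∣≤ ∣bs∣≤) , λ where
        a∈fi (here refl)  a∈fj → ∈-++⁺ˡ (as-cover a∈fi a∈fj)
        a∈fi (there j∈js) a∈fj → ∈-++⁺ʳ as (bs-cover a∈fi j∈js a∈fj)

    pack : ∀ {js} → Unique js → (∀ {j} → j List.∈ js → j List.∈ is) →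
      (∃[ vs ] Unique vs × From js vs × length js * M ≤ 2 * length vs) ⊎ M * M ≤ 4 * D * length U
    pack [] js⊆is = inj₁ ([] , [] , (λ ()) , z≤n)
    pack {i ∷ js} (i∉js ∷ js!) js⊆is with pack js! (js⊆is ∘ there)
    ... | inj₂ large = inj₂ large
    ... | inj₁ (vs , vs! , vs-from , tM≤2∣vs∣) with 2 * (length js * D) ≤? M
    ...   | no 2tD≰M = inj₂ (begin
      M * M                            ≤⟨ *-monoˡ-≤ M (<⇒≤ (≰⇒> 2tD≰M)) ⟩
      2 * (length js * D) * M          ≡⟨ rearrange (length js) D M ⟩
      2 * D * (length js * M)          ≤⟨ *-monoʳ-≤ (2 * D) tM≤2∣vs∣ ⟩
      2 * D * (2 * length vs)          ≡⟨ rearrange′ D (length vs) ⟩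
      4 * D * length vs                ≤⟨ *-monoʳ-≤ (4 * D) (packed-≤ (js⊆is ∘ there) vs! vs-from) ⟩
      4 * D * length U                 ∎)
      where
      open ≤-Reasoning
      rearrange : ∀ t d m → 2 * (t * d) * m ≡ 2 * d * (t * m)
      rearrange = solve-∀
      rearrange′ : ∀ d v → 2 * d * (2 * v) ≡ 4 * d * v
      rearrange′ = solve-∀
    ...   | yes 2tD≤M with as , ∣as∣≤ , as-cover ← overlaps (js⊆is (here refl)) (js⊆is ∘ there) i∉js =
      inj₁ (new ++ vs , new++vs! , from , count)
      where
      open ≤-Reasoning
      open DecMembership _≟ᴬ_ using (_∈?_)
      new? = λ a → ¬? (a ∈? vs)
      new = filter new? (f i)
      new++vs! : Unique (new ++ vs)
      new++vs! = Unique.++⁺ (Unique.filter⁺ new? (f! (js⊆is (here refl)))) vs!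
        (λ (a∈new , a∈vs) → proj₂ (∈-filter⁻ new? {xs = f i} a∈new) a∈vs)
      from : From (i ∷ js) (new ++ vs)
      from a∈ with ∈-++⁻ new a∈
      ... | inj₁ a∈new = i , here refl , proj₁ (∈-filter⁻ new? a∈new)
      ... | inj₂ a∈vs with j , j∈js , a∈fj ← vs-from a∈vs = j , there j∈js , a∈fj
      -- An element of f i that is not new lies in an earlier f j, hence in the overlap list, so
      -- `new` and `as` account for all M elements.
      fi⊆ : ∀ {a} → a List.∈ f i → a List.∈ new ++ as
      fi⊆ {a} a∈fi with a ∈? vs
      ... | no a∉vs = ∈-++⁺ˡ (∈-filter⁺ new? a∈fi a∉vs)
      ... | yes a∈vs with j , j∈js , a∈fj ← vs-from a∈vs = ∈-++⁺ʳ new (as-cover a∈fi j∈js a∈fj)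
      M≤ : M ≤ length new + length js * D
      M≤ = begin
        M                          ≡⟨ length-f i ⟨
        length (f i)               ≤⟨ unique-⊆⇒length-≤ (f! (js⊆is (here refl))) fi⊆ ⟩
        length (new ++ as)         ≡⟨ length-++ new ⟩
        length new + length as     ≤⟨ +-monoʳ-≤ (length new) ∣as∣≤ ⟩
        length new + length js * D ∎
      M≤2∣new∣ : M ≤ 2 * length new
      -- Doubling avoids M/2: 2M ≤ 2|new| + 2tD ≤ 2|new| + M, and M cancels.
      M≤2∣new∣ = +-cancelʳ-≤ M M (2 * length new) (begin
        M + M                                    ≡⟨ cong (_+_ M) (+-identityʳ M) ⟨
        2 * M                                    ≤⟨ *-monoʳ-≤ 2 M≤ ⟩
        2 * (length new + length js * D)         ≡⟨ *-distribˡ-+ 2 (length new) _ ⟩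
        2 * length new + 2 * (length js * D)     ≤⟨ +-monoʳ-≤ (2 * length new) 2tD≤M ⟩
        2 * length new + M                       ∎)
      count : suc (length js) * M ≤ 2 * length (new ++ vs)
      count = begin
        M + length js * M                  ≤⟨ +-mono-≤ M≤2∣new∣ tM≤2∣vs∣ ⟩
        2 * length new + 2 * length vs     ≡⟨ *-distribˡ-+ 2 (length new) _ ⟨
        2 * (length new + length vs)       ≡⟨ cong (2 *_) (length-++ new) ⟨
        2 * length (new ++ vs)             ∎

-- Division with junk value m / 0 = 0.
_div_ : ℕ → ℕ → ℕ
m div zero    = 0
m div (suc n) = m / suc n

*-div : ∀ m n .{{_ : NonZero n}} → (m * n) div n ≡ m
*-div m (suc n) = m*n/n≡m m (suc n)

-- As h is a natural number, b ≤ a. Substituting a = b + c turns (a - b)(a + b) into c (2b + c)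
-- without truncated subtraction.
≤⇒squareDiff : ∀ {a b h} → b * b + h ≡ a * a → ∃[ c ] a ≡ b + c × h ≡ c * (2 * b + c)
≤⇒squareDiff {a} {b} {h} eq with b ≤? a
... | no b≰a = contradiction (*-mono-< (≰⇒> b≰a) (≰⇒> b≰a))
                 (≤⇒≯ (≤-trans (m≤m+n (b * b) h) (≤-reflexive eq)))
... | yes b≤a with c , refl ← m≤n⇒∃[o]m+o≡n b≤a =
  c , refl , +-cancelˡ-≡ (b * b) h _ (trans eq (expand b c))
  where
  expand : ∀ b c → (b + c) * (b + c) ≡ b * b + c * (2 * b + c)
  expand = solve-∀

-- If h = a² - b², then e = a + b divides h, and e ± h/e are 2a and 2b.
module _ (h : ℕ) .{{h≢0 : NonZero h}} {ds : List ℕ} (cover : CoversDivisors h ds) where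

  private
    half-square = λ m → (m / 2) * (m / 2)

    squareDiff-divisor : ∀ {a b} → b * b + h ≡ a * a →
      ∃[ e ] e List.∈ ds × e + h div e ≡ a * 2 × e ∸ h div e ≡ b * 2
    squareDiff-divisor {a} {b} eq with c , refl , h≡ ← ≤⇒squareDiff {a} {b} eq =
      e , cover e (divides c h≡) ,
      trans (cong (_+_ e) h/e≡c) (2a b c) ,
      trans (cong (e ∸_) h/e≡c) (trans (m+n∸n≡m (2 * b) c) (*-comm 2 b))
      where
      e = 2 * b + c
      e≢0 : NonZero e
      -- As c e = h is nonzero, so is e, and the junk value of `_div_` is not met.
      e≢0 = m*n≢0⇒n≢0 c {{subst NonZero h≡ h≢0}}
      h/e≡c : h div e ≡ c
      h/e≡c = trans (cong (_div e) h≡) (*-div c e {{e≢0}})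
      2a : ∀ b c → 2 * b + c + c ≡ (b + c) * 2
      2a = solve-∀

    half-square-∈ : ∀ (g : ℕ → ℕ) {e} c → e List.∈ ds → g e ≡ c * 2 →
      c * c List.∈ map (half-square ∘ g) ds
    half-square-∈ g c e∈ds eq = subst (List._∈ map (half-square ∘ g) ds)
      (trans (cong half-square eq) (cong₂ _*_ (m*n/n≡m c 2) (m*n/n≡m c 2)))
      (∈-map⁺ (half-square ∘ g) e∈ds)

  -- One entry per e suffices because e determines the pair (a, b); an e that comes from no pair
  -- only yields a stray entry.
  largerSquares : ∃[ ss ] length ss ≡ length ds × (∀ a b → b * b + h ≡ a * a → a * a List.∈ ss)
  largerSquares = map (half-square ∘ λ e → e + h div e) ds , length-map _ ds , λ a b eq →
    let e , e∈ds , 2a , _ = squareDiff-divisor {a} {b} eq in half-square-∈ (λ e → e + h div e) a e∈ds 2a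

  smallerSquares : ∃[ ss ] length ss ≡ length ds × (∀ a b → b * b + h ≡ a * a → b * b List.∈ ss)
  smallerSquares = map (half-square ∘ λ e → e ∸ h div e) ds , length-map _ ds , λ a b eq →
    let e , e∈ds , _ , 2b = squareDiff-divisor {a} {b} eq in half-square-∈ (λ e → e ∸ h div e) b e∈ds 2b

-- For every exceptional n, the m translates n - s with s ∈ S and s ≤ N avoid A.
exceptional-dichotomy : ∀ {S A : Pred ℕ 0ℓ} {N D m x y} → S ⊆ Powers 2 →
  (∀ h .{{_ : NonZero h}} → h ≤ N → ∃[ ds ] CoversDivisors h ds × length ds ≤ D) →
  ∣ S ∣⟨ 0 , N ⟩≔ m → ∣ (A ⊕ S) ᶜ ∣⟨ 2 * N , 3 * N ⟩≔ x → ∣ A ᶜ ∣⟨ N , 3 * N ⟩≔ y →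
  x * m ≤ 2 * y ⊎ m * m ≤ 4 * D * y
exceptional-dichotomy {S} {A} {N} {D} S⊆squares bound
  (ss , ss! , refl , ss⇔) (zs , zs! , refl , zs⇔) (ys , ys! , refl , ys⇔) =
  packing _≟_ translate {D = D} (λ z → length-map (z ∸_) ss) zs! translate! translate⊆ys overlap-≤
  where
  translate : ℕ → List ℕ
  translate z = map (z ∸_) ss

  ss⁻ : ∀ {s} → s List.∈ ss → s ∈ S × s ≤ N
  ss⁻ s∈ss with s∈S , _ , s≤N ← Equivalence.to (ss⇔ _) s∈ss = s∈S , s≤N

  zs⁻ : ∀ {z} → z List.∈ zs → z ∈ (A ⊕ S) ᶜ × 2 * N < z × z ≤ 3 * N
  zs⁻ z∈zs = Equivalence.to (zs⇔ _) z∈zs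

  s≤z : ∀ {s z} → s List.∈ ss → z List.∈ zs → s ≤ z
  s≤z s∈ss z∈zs = ≤-trans (proj₂ (ss⁻ s∈ss)) (≤-trans (m≤m+n N _) (<⇒≤ (proj₁ (proj₂ (zs⁻ z∈zs)))))

  translate! : ∀ {z} → z List.∈ zs → Unique (translate z)
  translate! {z} z∈zs = map-unique (z ∸_)
    (λ s∈ss t∈ss eq → ∸-cancelˡ-≡ (s≤z s∈ss z∈zs) (s≤z t∈ss z∈zs) eq) ss!

  translate⊆ys : ∀ {z a} → z List.∈ zs → a List.∈ translate z → a List.∈ ys
  -- If z - s were in A, then z = (z - s) + s would lie in A + S; and z > 2N with s ≤ N puts z - s
  -- above N.
  translate⊆ys {z} z∈zs a∈ with s , s∈ss , refl ← ∈-map⁻ (z ∸_) a∈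
    with (0<z , z∉A⊕S) , 2N<z , z≤3N ← zs⁻ z∈zs | s∈S , s≤N ← ss⁻ s∈ss =
    Equivalence.from (ys⇔ (z ∸ s))
      ( (≤-<-trans z≤n N<z∸s , λ a∈A → z∉A⊕S (z ∸ s , s , a∈A , s∈S , sym (m∸n+n≡m (s≤z s∈ss z∈zs))))
      , N<z∸s , ≤-trans (m∸n≤m z s) z≤3N)
    where
    open ≤-Reasoning
    N<z∸s : N < z ∸ s
    N<z∸s = +-cancelʳ-< s N (z ∸ s) (begin-strict
      N + s        ≤⟨ +-monoʳ-≤ N s≤N ⟩
      N + N        ≡⟨ cong (_+_ N) (+-identityʳ N) ⟨
      2 * N        <⟨ 2N<z ⟩
      z            ≡⟨ m∸n+n≡m (s≤z s∈ss z∈zs) ⟨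
      z ∸ s + s    ∎)

  square : ∀ {s} → s List.∈ ss → ∃[ a ] s ≡ a * a
  square s∈ss with n , _ , refl ← S⊆squares (proj₁ (ss⁻ s∈ss)) = n , cong (n *_) (*-identityʳ n)

  -- Two points of (2N, 3N] are at most N apart, which keeps h in the range of `bound`.
  gap : ∀ {z w} → z List.∈ zs → w List.∈ zs → z < w → ∃[ h ] NonZero h × h ≤ N × z + h ≡ w
  gap {z} {w} z∈zs w∈zs z<w = w ∸ z , >-nonZero (m<n⇒0<n∸m z<w) ,
    m≤n+o⇒m∸n≤o w z (begin
      w              ≤⟨ proj₂ (proj₂ (zs⁻ w∈zs)) ⟩
      3 * N          ≡⟨ +-comm N (2 * N) ⟩
      2 * N + N      ≤⟨ +-monoˡ-≤ N (<⇒≤ (proj₁ (proj₂ (zs⁻ z∈zs)))) ⟩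
      z + N          ∎) ,
    m+[n∸m]≡n (<⇒≤ z<w)
    where open ≤-Reasoning

  squares-differ : ∀ {z h s t} → s List.∈ ss → t List.∈ ss → z List.∈ zs → z + h List.∈ zs →
    (z + h) ∸ t ≡ z ∸ s → s + h ≡ t
  squares-differ {z} {h} {s} {t} s∈ss t∈ss z∈zs w∈zs eq = +-cancelʳ-≡ (z ∸ s) (s + h) t (begin-equality
    s + h + (z ∸ s)      ≡⟨ rearrange s h (z ∸ s) ⟩
    s + (z ∸ s) + h      ≡⟨ cong (_+ h) (m+[n∸m]≡n (s≤z s∈ss z∈zs)) ⟩
    z + h                ≡⟨ m+[n∸m]≡n (s≤z t∈ss w∈zs) ⟨
    t + ((z + h) ∸ t)    ≡⟨ cong (_+_ t) eq ⟩
    t + (z ∸ s)          ∎)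
    where
    open ≤-Reasoning
    rearrange : ∀ s h d → s + h + d ≡ s + d + h
    rearrange = solve-∀

  overlap-≤ : ∀ {z w} → z List.∈ zs → w List.∈ zs → z ≢ w →
    ∃[ as ] length as ≤ D × (∀ {a} → a List.∈ translate z → a List.∈ translate w → a List.∈ as)
  overlap-≤ {z} {w} z∈zs w∈zs z≢w with <-cmp z w
  ... | tri≈ _ z≡w _ = contradiction z≡w z≢w
  -- A common element z - s = w - t has t = s + h, so the square taken from z is the smaller one
  -- here and the larger one when w < z.
  ... | tri< z<w _ _ with h , h≢0 , h≤N , refl ← gap z∈zs w∈zs z<w
    with ds , cover , ∣ds∣≤D ← bound h {{h≢0}} h≤N
    with sq , ∣sq∣ , smaller ← smallerSquares h {{h≢0}} cover =
    map (z ∸_) sq , ≤-trans (≤-reflexive (trans (length-map (z ∸_) sq) ∣sq∣)) ∣ds∣≤D , covered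
    where
    covered : ∀ {a} → a List.∈ translate z → a List.∈ translate (z + h) → a List.∈ map (z ∸_) sq
    covered a∈z a∈w with s , s∈ss , refl ← ∈-map⁻ (z ∸_) a∈z | t , t∈ss , eq ← ∈-map⁻ ((z + h) ∸_) a∈w
      with s+h≡t ← squares-differ s∈ss t∈ss z∈zs w∈zs (sym eq) | b , refl ← square s∈ss | a , refl ← square t∈ss =
      ∈-map⁺ (z ∸_) (smaller a b s+h≡t)
  ... | tri> _ _ w<z with h , h≢0 , h≤N , refl ← gap w∈zs z∈zs w<z
    with ds , cover , ∣ds∣≤D ← bound h {{h≢0}} h≤N
    with sq , ∣sq∣ , larger ← largerSquares h {{h≢0}} cover =
    map ((w + h) ∸_) sq , ≤-trans (≤-reflexive (trans (length-map ((w + h) ∸_) sq) ∣sq∣)) ∣ds∣≤D , covered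
    where
    covered : ∀ {a} → a List.∈ translate (w + h) → a List.∈ translate w → a List.∈ map ((w + h) ∸_) sq
    covered a∈z a∈w with t , t∈ss , refl ← ∈-map⁻ ((w + h) ∸_) a∈z | s , s∈ss , eq ← ∈-map⁻ (w ∸_) a∈w
      with s+h≡t ← squares-differ s∈ss t∈ss w∈zs z∈zs eq | b , refl ← square s∈ss | a , refl ← square t∈ss =
      ∈-map⁺ ((w + h) ∸_) (larger a b s+h≡t)

-- Cardinalities and rational exponents

-- Excluded middle for a single membership holds under double negation, and the induction on b uses
-- it once for each number below b.
¬¬-HasCard : ∀ (P : Pred ℕ 0ℓ) b → (∀ {n} → n ∈ P → n < b) → ¬ ¬ (∃[ m ] HasCard P m)
¬¬-HasCard P zero    P<b k = k (0 , [] , [] , refl , λ n → mk⇔ (λ ()) (λ n∈P → contradiction (P<b n∈P) n≮0))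
¬¬-HasCard P (suc b) P<1+b k = ¬¬-HasCard (P ∩ (_< b)) b proj₂
  λ (m , xs , xs! , ∣xs∣ , xs⇔) → ¬¬-excluded-middle {A = b ∈ P} λ where
    (yes b∈P) → k (suc m , b ∷ xs
      , All.tabulate (λ { {x} x∈xs refl → <-irrefl refl (proj₂ (Equivalence.to (xs⇔ x) x∈xs)) }) ∷ xs!
      , cong suc ∣xs∣
      , λ n → mk⇔ (λ { (here refl) → b∈P ; (there n∈xs) → proj₁ (Equivalence.to (xs⇔ n) n∈xs) })
                  (λ n∈P → insert xs⇔ n∈P (m≤n⇒m<n∨m≡n (s≤s⁻¹ (P<1+b n∈P)))))
    (no b∉P) → k (m , xs , xs! , ∣xs∣ , λ n → mk⇔ (λ n∈xs → proj₁ (Equivalence.to (xs⇔ n) n∈xs))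
      (λ n∈P → Equivalence.from (xs⇔ n) (n∈P , ≤∧≢⇒< (s≤s⁻¹ (P<1+b n∈P)) λ { refl → b∉P n∈P })))
  where
  insert : ∀ {xs n} → (∀ n → (n List.∈ xs) ⇔ (n ∈ P ∩ (_< b))) → n ∈ P → n < b ⊎ n ≡ b → n List.∈ b ∷ xs
  insert xs⇔ n∈P (inj₁ n<b)  = there (Equivalence.from (xs⇔ _) (n∈P , n<b))
  insert xs⇔ n∈P (inj₂ refl) = here refl

¬¬-card : ∀ C a b → ¬ ¬ (∃[ m ] ∣ C ∣⟨ a , b ⟩≔ m)
¬¬-card C a b = ¬¬-HasCard (C ∩ ⦅ a , b ⟧) (suc b) (λ (_ , _ , n≤b) → s≤s n≤b)

HasCard-mono : ∀ {P Q m n} → P ⊆ Q → HasCard P m → HasCard Q n → m ≤ n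
HasCard-mono P⊆Q (_ , xs! , refl , xs⇔) (_ , _ , refl , ys⇔) =
  unique-⊆⇒length-≤ _≟_ xs! λ x∈xs → Equivalence.from (ys⇔ _) (P⊆Q (Equivalence.to (xs⇔ _) x∈xs))

-- Both z⁺ - z⁻ and a - b equal z; rearranging into sums keeps the identity in ℕ.
⁺⁻-cross : ∀ z {a b} → z ℤ.+ + b ≡ + a → z ⁺ + b ≡ z ⁻ + a
⁺⁻-cross (+ n)    {a} {b} eq = ℤ.+-injective eq
⁺⁻-cross -[1+ n ] {a} {b} eq = ℤ.+-injective (trans (rearrange (+ suc n) (+ b)) (cong (λ t → + suc n ℤ.+ t) eq))
  where
  rearrange : ∀ x y → y ≡ x ℤ.+ (ℤ.- x ℤ.+ y)
  rearrange = ℤ.solve-∀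

⁺-neg : ∀ z → (ℤ.- z) ⁺ ≡ z ⁻
⁺-neg (+ zero)  = refl
⁺-neg (+ suc n) = refl
⁺-neg -[1+ n ]  = refl

⁻-neg : ∀ z → (ℤ.- z) ⁻ ≡ z ⁺
⁻-neg (+ zero)  = refl
⁻-neg (+ suc n) = refl
⁻-neg -[1+ n ]  = refl

-- Any a - b = z may replace z⁺ - z⁻ as exponent: multiply by N^b, trade N^(z⁺ + b) for N^(z⁻ + a),
-- cancel N^(z⁻). This serves where the sign of z is not known.
module _ (N : ℕ) (z : ℤ) {a b} (z+b≡a : z ℤ.+ + b ≡ + a) (X : ℕ) .{{_ : NonZero N}} where

  private
    split : N ^ (z ⁺) * N ^ b ≡ N ^ (z ⁻) * N ^ a
    split = trans (sym (^-distribˡ-+-* N (z ⁺) b))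
                  (trans (cong (N ^_) (⁺⁻-cross z z+b≡a)) (^-distribˡ-+-* N (z ⁻) a))

    swap : ∀ x y w → x * y * w ≡ x * (w * y)
    swap = solve-∀

  N^z<X⇒N^a<N^b*X : N ^ (z ⁺) < N ^ (z ⁻) * X → N ^ a < N ^ b * X
  N^z<X⇒N^a<N^b*X N^z<X = *-cancelˡ-< (N ^ (z ⁻)) _ _ (begin-strict
    N ^ (z ⁻) * N ^ a          ≡⟨ split ⟨
    N ^ (z ⁺) * N ^ b          <⟨ *-monoˡ-< (N ^ b) {{m^n≢0 N b}} N^z<X ⟩
    N ^ (z ⁻) * X * N ^ b      ≡⟨ swap (N ^ (z ⁻)) X (N ^ b) ⟩
    N ^ (z ⁻) * (N ^ b * X)    ∎)
    where open ≤-Reasoning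

  X<N^z⇒N^b*X<N^a : N ^ (z ⁻) * X < N ^ (z ⁺) → N ^ b * X < N ^ a
  X<N^z⇒N^b*X<N^a X<N^z = *-cancelˡ-< (N ^ (z ⁻)) _ _ (begin-strict
    N ^ (z ⁻) * (N ^ b * X)    ≡⟨ swap (N ^ (z ⁻)) X (N ^ b) ⟨
    N ^ (z ⁻) * X * N ^ b      <⟨ *-monoˡ-< (N ^ b) {{m^n≢0 N b}} X<N^z ⟩
    N ^ (z ⁺) * N ^ b          ≡⟨ split ⟩
    N ^ (z ⁻) * N ^ a          ∎)
    where open ≤-Reasoning

positive-numerator : ∀ p → 0ℚᵘ ℚᵘ.< p → ∃[ n ] ∃[ d-1 ] p ≡ mkℚᵘ (+ suc n) d-1
positive-numerator (mkℚᵘ (+ suc n) d-1) _                 = n , d-1 , refl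
positive-numerator (mkℚᵘ (+ zero)  _)   (ℚᵘ.*<* (ℤ.+<+ ()))
positive-numerator (mkℚᵘ -[1+ _ ]  _)   (ℚᵘ.*<* ())

-- With e = r + 1 the exponent 1/2 - 1/e is (e - 2)/(2e); the factor N^2 carries the -2 to the other
-- side.
density-1/e : ∀ N M r .{{_ : NonZero N}} → [ N ^ (+ 1 ℚᵘ./ 2) ℚᵘ.- mkℚᵘ (+ 1) r ]< M →
  N ^ suc r < N ^ 2 * M ^ (2 * suc r)
density-1/e N M r = N^z<X⇒N^a<N^b*X N (↥ ((+ 1 ℚᵘ./ 2) ℚᵘ.- mkℚᵘ (+ 1) r)) (lemma (+ suc r)) (M ^ (2 * suc r))
  where
  lemma : ∀ x → (+ 1 ℤ.* x ℤ.+ -[1+ 0 ] ℤ.* + 2) ℤ.+ + 2 ≡ x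
  lemma = ℤ.solve-∀

-- Here δ = (d + 1)/(q + 1). Dropping N^d ≥ 1 weakens it to 1/(q + 1), so only the denominator of δ
-- survives.
growth-1-δ : ∀ N w d q .{{_ : NonZero N}} → w <[ N ^ 1ℚᵘ ℚᵘ.- mkℚᵘ (+ suc d) q ] →
  N * w ^ suc q ≤ N ^ suc q
growth-1-δ N w d q w< = begin
  N * w ^ suc q              ≤⟨ *-monoˡ-≤ (w ^ suc q) (m≤m*n N (N ^ d) {{m^n≢0 N d}}) ⟩
  N ^ suc d * w ^ suc q      ≤⟨ <⇒≤ (X<N^z⇒N^b*X<N^a N z (lemma (+ suc q) (+ suc d)) (w ^ suc q)
                                  (subst (λ t → N ^ (z ⁻) * w ^ t < N ^ (z ⁺)) (*-identityˡ (suc q)) w<)) ⟩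
  N ^ suc q                  ∎
  where
  open ≤-Reasoning
  z = ↥ (1ℚᵘ ℚᵘ.- mkℚᵘ (+ suc d) q)
  lemma : ∀ x y → (+ 1 ℤ.* x ℤ.+ (ℤ.- y) ℤ.* + 1) ℤ.+ y ≡ x
  lemma = ℤ.solve-∀

-- Divide x M ≤ 2y by M > N^(1/2-ε). The exponents ε - 1/2 and 1/2 - ε are opposite, so their
-- positive and negative parts trade places.
density-ε⇒bound : ∀ ε N x y M → [ N ^ (+ 1 ℚᵘ./ 2) ℚᵘ.- ε ]< M → x * M ≤ 2 * y → x ≤[ N ^ ε ℚᵘ.- ½ ]* (2 * y)
density-ε⇒bound ε@(mkℚᵘ p q) N x y M dense xM≤2y = begin
  N ^ (z ⁻) * x ^ Q              ≡⟨ cong (λ t → N ^ t * x ^ Q) z⁻≡w⁺ ⟩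
  N ^ (w ⁺) * x ^ Q              ≤⟨ *-monoˡ-≤ (x ^ Q) (<⇒≤ dense′) ⟩
  N ^ (w ⁻) * M ^ Q * x ^ Q      ≡⟨ *-assoc (N ^ (w ⁻)) (M ^ Q) (x ^ Q) ⟩
  N ^ (w ⁻) * (M ^ Q * x ^ Q)    ≡⟨ cong (N ^ (w ⁻) *_) (^-distribʳ-* M x Q) ⟨
  N ^ (w ⁻) * (M * x) ^ Q        ≡⟨ cong (λ t → N ^ (w ⁻) * t ^ Q) (*-comm M x) ⟩
  N ^ (w ⁻) * (x * M) ^ Q        ≤⟨ *-monoʳ-≤ (N ^ (w ⁻)) (^-monoˡ-≤ Q xM≤2y) ⟩
  N ^ (w ⁻) * (2 * y) ^ Q        ≡⟨ cong (λ t → N ^ t * (2 * y) ^ Q) z⁺≡w⁻ ⟨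
  N ^ (z ⁺) * (2 * y) ^ Q        ∎
  where
  open ≤-Reasoning
  z = ↥ (ε ℚᵘ.- ½)
  w = ↥ ((+ 1 ℚᵘ./ 2) ℚᵘ.- ε)
  Q = ↧ₙ (ε ℚᵘ.- ½)
  z≡-w : z ≡ ℤ.- w
  z≡-w = lemma p (+ suc q)
    where
    lemma : ∀ x y → x ℤ.* + 2 ℤ.+ -[1+ 0 ] ℤ.* y ≡ ℤ.- (+ 1 ℤ.* y ℤ.+ (ℤ.- x) ℤ.* + 2)
    lemma = ℤ.solve-∀
  z⁻≡w⁺ : z ⁻ ≡ w ⁺
  z⁻≡w⁺ = trans (cong _⁻ z≡-w) (⁻-neg w)
  z⁺≡w⁻ : z ⁺ ≡ w ⁻
  z⁺≡w⁻ = trans (cong _⁺ z≡-w) (⁺-neg w)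
  dense′ : N ^ (w ⁺) < N ^ (w ⁻) * M ^ Q
  dense′ = subst (λ t → N ^ (w ⁺) < N ^ (w ⁻) * M ^ t) (*-comm 2 (suc q)) dense

-- Integer roots and the contradiction for large N

integerRoot : ∀ k .{{_ : NonZero k}} B → ∃[ D ] D ^ k ≤ B × (∀ x → x ^ k ≤ B → x ≤ D)
integerRoot k@(suc k-1) B = search B (λ x x^k≤B → ≤-trans (x≤x^k x) x^k≤B)
  where
  x≤x^k : ∀ x → x ≤ x ^ k
  x≤x^k zero      = z≤n
  x≤x^k x@(suc _) = m≤m*n x (x ^ k-1) {{m^n≢0 x k-1}}
  -- The search descends from B, an upper bound because x ≤ x^k, so the first success is the largest
  -- root.
  search : ∀ b → (∀ x → x ^ k ≤ B → x ≤ b) → ∃[ D ] D ^ k ≤ B × (∀ x → x ^ k ≤ B → x ≤ D)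
  search b ≤b with b ^ k ≤? B
  ... | yes b^k≤B = b , b^k≤B , ≤b
  search zero    ≤b | no 0≰B = contradiction z≤n 0≰B
  search (suc b) ≤b | no b^k≰B = search b λ x x^k≤B →
    s≤s⁻¹ (≤∧≢⇒< (≤b x x^k≤B) λ { refl → b^k≰B x^k≤B })

-- With θ = 1/q this is the contradiction between M² ≤ 4Dy, D ≤ (CN)^(θ/4),
-- y ≤ w ≤ (3N)^(1-θ) and M² > N^(1-θ/2), for N large.
large-M-impossible : ∀ N M D y w C q .{{_ : NonZero N}} → let e = 4 * q in
  N ^ e < N ^ 2 * M ^ (2 * e) → M * M ≤ 4 * D * y → D ^ e ≤ C * N →
  y ≤ w → 3 * N * w ^ q ≤ (3 * N) ^ q → N ≤ 12 ^ e * C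
large-M-impossible N M D y w C q dense M²≤4Dy D^e≤CN y≤w sparse =
  *-cancelʳ-≤ N (12 ^ e * C) (N ^ 3 * N ^ e) {{m*n≢0 (N ^ 3) (N ^ e) {{m^n≢0 N 3}} {{m^n≢0 N e}}}} (begin
    N * (N ^ 3 * N ^ e)                       ≡⟨ *-assoc N (N ^ 3) (N ^ e) ⟨
    -- The factor X^4 prepares for the sparsity bound, raised to the fourth power because e = 4q.
    -- The gain N^4 outweighs the N^2 of the density and the N of the divisor bound, leaving a
    -- surplus N.
    N ^ 4 * N ^ e                             ≤⟨ *-mono-≤ (^-monoˡ-≤ 4 (m≤n*m N 3)) (<⇒≤ dense) ⟩
    X ^ 4 * (N ^ 2 * M ^ (2 * e))             ≤⟨ *-monoʳ-≤ (X ^ 4) (*-monoʳ-≤ (N ^ 2) M^2e≤) ⟩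
    X ^ 4 * (N ^ 2 * (4 ^ e * (C * N) * w ^ e))   ≡⟨ rearrange (X ^ 4) (N ^ 2) (4 ^ e) (C * N) (w ^ e) ⟩
    N ^ 2 * (4 ^ e * (C * N)) * (X ^ 4 * w ^ e)   ≤⟨ *-monoʳ-≤ (N ^ 2 * (4 ^ e * (C * N))) X^4w^e≤X^e ⟩
    N ^ 2 * (4 ^ e * (C * N)) * X ^ e             ≡⟨ cong (N ^ 2 * (4 ^ e * (C * N)) *_) (^-distribʳ-* 3 N e) ⟩
    N ^ 2 * (4 ^ e * (C * N)) * (3 ^ e * N ^ e)   ≡⟨ rearrange′ N (4 ^ e) C (3 ^ e) (N ^ e) ⟩
    -- In 12 = 4 · 3, the 4 comes from M² ≤ 4Dy and the 3 from X = 3N.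
    4 ^ e * 3 ^ e * C * (N ^ 3 * N ^ e)           ≡⟨ cong (λ t → t * C * (N ^ 3 * N ^ e)) (^-distribʳ-* 4 3 e) ⟨
    12 ^ e * C * (N ^ 3 * N ^ e)                  ∎)
  where
  open ≤-Reasoning
  e = 4 * q
  X = 3 * N
  rearrange : ∀ x n f c v → x * (n * (f * c * v)) ≡ n * (f * c) * (x * v)
  rearrange = solve-∀
  rearrange′ : ∀ n f c t m → n * (n * 1) * (f * (c * n)) * (t * m) ≡ f * t * c * (n * (n * (n * 1)) * m)
  rearrange′ = solve-∀
  M^2e≤ : M ^ (2 * e) ≤ 4 ^ e * (C * N) * w ^ e
  M^2e≤ = begin
    M ^ (2 * e)                  ≡⟨ ^-*-assoc M 2 e ⟨
    (M * (M * 1)) ^ e            ≡⟨ cong (λ t → (M * t) ^ e) (*-identityʳ M) ⟩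
    (M * M) ^ e                  ≤⟨ ^-monoˡ-≤ e (≤-trans M²≤4Dy (*-monoʳ-≤ (4 * D) y≤w)) ⟩
    (4 * D * w) ^ e              ≡⟨ ^-distribʳ-* (4 * D) w e ⟩
    (4 * D) ^ e * w ^ e          ≡⟨ cong (_* w ^ e) (^-distribʳ-* 4 D e) ⟩
    4 ^ e * D ^ e * w ^ e        ≤⟨ *-monoˡ-≤ (w ^ e) (*-monoʳ-≤ (4 ^ e) D^e≤CN) ⟩
    4 ^ e * (C * N) * w ^ e      ∎
  pow-4 : ∀ x → (x ^ q) ^ 4 ≡ x ^ e
  pow-4 x = trans (^-*-assoc x q 4) (cong (x ^_) (*-comm q 4))
  X^4w^e≤X^e : X ^ 4 * w ^ e ≤ X ^ e
  X^4w^e≤X^e = begin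
    X ^ 4 * w ^ e          ≡⟨ cong (X ^ 4 *_) (pow-4 w) ⟨
    X ^ 4 * (w ^ q) ^ 4    ≡⟨ ^-distribʳ-* X (w ^ q) 4 ⟨
    (X * w ^ q) ^ 4        ≤⟨ ^-monoˡ-≤ 4 sparse ⟩
    (X ^ q) ^ 4            ≡⟨ pow-4 X ⟩
    X ^ e                  ∎

theorem1p2 : ∀ (ε : ℚᵘ) → 0ℚᵘ ℚᵘ.< ε →
    ∃[ K ] (∀ (S A : Pred ℕ 0ℓ) →
    HighDensity 2 S →
    A ⊆ ℕ⁺ →
    ComplementaryGrowthExponent< 1ℚᵘ A →
    Eventually λ N → ∀ x y →
    ∣ (A ⊕ S) ᶜ ∣⟨ 2 * N , 3 * N ⟩≔ x →
    ∣ A ᶜ ∣⟨ N , 3 * N ⟩≔ y →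
    x ≤[ N ^ ε ℚᵘ.- ½ ]* (K * y))
-- The constant is the 2 of x m ≤ 2y, the same for all ε.
theorem1p2 ε 0<ε = 2 , eventually
  where
  eventually : ∀ S A → HighDensity 2 S → A ⊆ ℕ⁺ → ComplementaryGrowthExponent< 1ℚᵘ A →
    Eventually λ N → ∀ x y → ∣ (A ⊕ S) ᶜ ∣⟨ 2 * N , 3 * N ⟩≔ x → ∣ A ᶜ ∣⟨ N , 3 * N ⟩≔ y →
      x ≤[ N ^ ε ℚᵘ.- ½ ]* (2 * y)
  eventually S A (S⊆squares , S-dense) _ (δ , 0<δ , N₃ , A-sparse)
    with d , q-1 , refl ← positive-numerator δ 0<δ
    with C , few-divisors ← divisorBound (4 * suc q-1)
       | N₁ , dense-ε ← S-dense ε 0<ε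
       -- The density of S is used a second time, at 1/(4q), which δ alone determines; `mkℚᵘ` takes
       -- the denominator minus one, whence `pred`.
       | N₂ , dense-1/e ← S-dense (mkℚᵘ (+ 1) (pred (4 * suc q-1))) (ℚᵘ.positive⁻¹ _) =
    -- The last entry forces N > 12^e C, against the conclusion of `large-M-impossible`, and makes N
    -- nonzero.
    N₁ ⊔ N₂ ⊔ N₃ ⊔ suc (12 ^ e * C) , bound
    where
    q = suc q-1
    e = 4 * q
    bound : ∀ N → N₁ ⊔ N₂ ⊔ N₃ ⊔ suc (12 ^ e * C) ≤ N → ∀ x y →
      ∣ (A ⊕ S) ᶜ ∣⟨ 2 * N , 3 * N ⟩≔ x → ∣ A ᶜ ∣⟨ N , 3 * N ⟩≔ y → x ≤[ N ^ ε ℚᵘ.- ½ ]* (2 * y)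
    bound N N₀≤N x y card-x card-y = decidable-stable (_ ≤? _) λ ¬goal →
      ¬¬-card S 0 N λ (m , card-m) → ¬¬-card (A ᶜ) 0 (3 * N) λ (w , card-w) → ¬goal (conclude card-m card-w)
      where
      N₁₂₃≤N = m⊔n≤o⇒m≤o (N₁ ⊔ N₂ ⊔ N₃) _ N₀≤N
      N₁₂≤N  = m⊔n≤o⇒m≤o (N₁ ⊔ N₂) N₃ N₁₂₃≤N
      12^e*C<N = m⊔n≤o⇒n≤o (N₁ ⊔ N₂ ⊔ N₃) _ N₀≤N
      instance
        N≢0 : NonZero N
        N≢0 = >-nonZero (≤-<-trans z≤n 12^e*C<N)
        3N≢0 : NonZero (3 * N)
        3N≢0 = m*n≢0 3 N
      conclude : ∀ {m w} → ∣ S ∣⟨ 0 , N ⟩≔ m → ∣ A ᶜ ∣⟨ 0 , 3 * N ⟩≔ w → x ≤[ N ^ ε ℚᵘ.- ½ ]* (2 * y)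
      -- `D`, the integer part of (C N)^(1/e), bounds the lengths of the covers for all h ≤ N at
      -- once.
      conclude {m} {w} card-m card-w with D , D^e≤CN , D-max ← integerRoot e (C * N)
        with exceptional-dichotomy {A = A} S⊆squares
          (λ h h≤N → let ds , cover , ∣ds∣^e≤Ch = few-divisors h in
            ds , cover , D-max (length ds) (≤-trans ∣ds∣^e≤Ch (*-monoʳ-≤ C h≤N)))
          card-m card-x card-y
      ... | inj₁ xm≤2y = density-ε⇒bound ε N x y m
        (dense-ε N (m⊔n≤o⇒m≤o N₁ N₂ N₁₂≤N) m card-m) xm≤2y
      ... | inj₂ m²≤4Dy = contradiction
        (large-M-impossible N m D y w C q
          (density-1/e N m (pred (4 * suc q-1)) (dense-1/e N (m⊔n≤o⇒n≤o N₁ N₂ N₁₂≤N) m card-m))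
          m²≤4Dy D^e≤CN
          -- The growth hypothesis counts from 0, so y is compared with the count w over (0, 3N].
          (HasCard-mono (λ (n∈Aᶜ , N<n , n≤3N) → n∈Aᶜ , ≤-<-trans z≤n N<n , n≤3N) card-y card-w)
          (growth-1-δ (3 * N) w d q-1
            (A-sparse (3 * N) (≤-trans (m⊔n≤o⇒n≤o (N₁ ⊔ N₂) N₃ N₁₂₃≤N) (m≤n*m N 3)) w card-w)))
        (<⇒≱ 12^e*C<N)
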